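{- Let $\mathsf{V}$ be a variety of semilinear commutative residuated lattices, or of semilinear commutative pointed residuated lattices. Then $\mathsf{V}$ has the amalgamation property if and only if the class $\mathsf{V}_{\mathrm{FSI}}$ of finitely subdirectly irreducible members of $\mathsf{V}$ has the essential amalgamation property.
   Context: A commutative residuated lattice is an algebra $\langle A,\wedge,\vee,\cdot,\to,1\rangle$ where $\langle A,\wedge,\vee\rangle$ is a lattice, $\langle A,\cdot,1\rangle$ is a commutative monoid and $xy\le z\iff x\le y\to z$. Pointed means that the signature is expanded by one additional constant symbol (with arbitrary interpretation). A variety of such algebras is semilinear if it is generated by its totally ordered members. An algebra is finitely subdirectly irreducible if whenever its least congruence is the intersection of a non-empty finite collection of congruences, it equals one of them (so trivial algebras are finitely subdirectly irreducible). A span in a class $\mathsf{K}$ is a pair of embeddings $\varphi_1\colon\mathbf{A}\to\mathbf{B}$, $\varphi_2\colon\mathbf{A}\to\mathbf{C}$ with $\mathbf{A},\mathbf{B},\mathbf{C}\in\mathsf{K}$; an amalgam of it in $\mathsf{K}$ is a pair of embeddings $\psi_1\colon\mathbf{B}\to\mathbf{D}$, $\psi_2\colon\mathbf{C}\to\mathbf{D}$ with $\mathbf{D}\in\mathsf{K}$ and $\psi_1\varphi_1=\psi_2\varphi_2$. $\mathsf{K}$ has the amalgamation property if every span in $\mathsf{K}$ has an amalgam in $\mathsf{K}$. An embedding $\varphi\colon\mathbf{A}\to\mathbf{B}$ is essential if every congruence of $\mathbf{B}$ other than the least congruence restricts to a congruence of the subalgebra $\varphi[\mathbf{A}]$ other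 than the least one. A span $\langle\varphi_1,\varphi_2\rangle$ is essential if $\varphi_2$ is an essential embedding. $\mathsf{K}$ has the essential amalgamation property if every essential span in $\mathsf{K}$ has an amalgam in $\mathsf{K}$. -}

module Defs where

open import Level using (Level; _⊔_) renaming (suc to lsuc)
open import Algebra.Core using (Op₂)
open import Algebra.Definitions using (Congruent₂)
open import Algebra.Structures using (IsCommutativeMonoid)
open import Algebra.Lattice.Structures using (IsLattice)
import Algebra.Morphism.Definitions as Morphism
open import Data.Empty using (⊥)
open import Data.Fin.Base using (Fin)
open import Data.Nat.Base using (ℕ; suc)
open import Data.Product.Base using (∃; ∃-syntax; _×_; proj₁)
open import Data.Sum.Base using (_⊎_)
open import Data.Unit.Base using (⊤)
open import Function.Bundles using (_⇔_)
open import Function.Definitions using (Injective)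
open import Relation.Binary.Bundles using (Poset)
open import Relation.Binary.Core using (Rel; _Preserves_⟶_) renaming (_⇔_ to _≐_)
open import Relation.Binary.Definitions using (Total)
open import Relation.Binary.Structures using (IsEquivalence)
import Relation.Binary.Construct.NaturalOrder.Left as NaturalOrder
open import Relation.Nullary.Negation.Core using (¬_)
open import Relation.Unary using (Pred; _∈_)

private variable
  ℓ k : Level

-- Zorn's lemma, used as an explicit hypothesis (the axiom of choice is not
-- available in Agda for setoids).  The empty chain is included, so the chain
-- condition makes P nonempty.

ZornsLemma : ∀ p → Set (lsuc p)
ZornsLemma p = (P : Poset p p p) → let open Poset P in
  (∀ (C : Pred Carrier p) →
     (∀ {x y} → x ∈ C → y ∈ C → x ≤ y ⊎ y ≤ x) →
     ∃[ u ] (∀ {x} → x ∈ C → x ≤ u)) →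
  ∃[ m ] (∀ {x} → m ≤ x → x ≈ m)

-- The two cases of the theory are treated uniformly: the signature is that of
-- residuated lattices together with either no or exactly one extra constant.

data Signature : Set where
  plain pointed : Signature

Constant : Signature → Set
Constant plain   = ⊥
Constant pointed = ⊤

-- Algebras are setoid-based: `_≈_` is the equality of the algebra, so that
-- quotients are obtained by changing `_≈_`.

record CRL (τ : Signature) (ℓ : Level) : Set (lsuc ℓ) where
  infix  4 _≈_
  infixr 5 _⇨_
  infixr 6 _∨_
  infixr 7 _∧_
  infixl 8 _∙_
  field
    Carrier             : Set ℓ
    _≈_                 : Rel Carrier ℓ
    _∧_ _∨_ _∙_ _⇨_     : Op₂ Carrier
    ε                   : Carrier
    const               : Constant τ → Carrier
    isLattice           : IsLattice _≈_ _∨_ _∧_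
    isCommutativeMonoid : IsCommutativeMonoid _≈_ _∙_ ε
    ⇨-cong              : Congruent₂ _≈_ _⇨_

  -- x ≤ y  is  x ≈ x ∧ y
  open NaturalOrder _≈_ _∧_ public using (_≤_)

  field
    residuation : ∀ x y z → (x ∙ y ≤ z) ⇔ (x ≤ y ⇨ z)

TotallyOrdered : ∀ {τ} → CRL τ ℓ → Set ℓ
TotallyOrdered A = Total (CRL._≤_ A)

data Term (τ : Signature) : Set where
  var                      : ℕ → Term τ
  _∧ᵗ_ _∨ᵗ_ _∙ᵗ_ _⇨ᵗ_      : Term τ → Term τ → Term τ
  εᵗ                       : Term τ
  constᵗ                   : Constant τ → Term τ

module _ {τ : Signature} (A : CRL τ ℓ) where
  open CRL A

  eval : (ℕ → Carrier) → Term τ → Carrier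
  eval ρ (var n)    = ρ n
  eval ρ (s ∧ᵗ t)   = eval ρ s ∧ eval ρ t
  eval ρ (s ∨ᵗ t)   = eval ρ s ∨ eval ρ t
  eval ρ (s ∙ᵗ t)   = eval ρ s ∙ eval ρ t
  eval ρ (s ⇨ᵗ t)   = eval ρ s ⇨ eval ρ t
  eval ρ εᵗ         = ε
  eval ρ (constᵗ c) = const c

Theory : Signature → (ℓ : Level) → Set (lsuc ℓ)
Theory τ ℓ = Term τ → Term τ → Set ℓ

infix 4 _⊨_

_⊨_ : ∀ {τ} → CRL τ ℓ → Theory τ ℓ → Set ℓ
A ⊨ E = ∀ {s t} → E s t → ∀ ρ → eval A ρ s ≈ eval A ρ t
  where open CRL A

-- Varieties are taken as equational classes.

Variety : ∀ {τ} → Theory τ ℓ → Pred (CRL τ ℓ) ℓ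
Variety E A = A ⊨ E

-- The variety is generated by its totally ordered members: every variety that
-- contains these contains the whole variety.

Semilinear : ∀ {τ} → Theory τ ℓ → Set (lsuc ℓ)
Semilinear {ℓ} {τ} E = (F : Theory τ ℓ) →
  (∀ A → A ∈ Variety E → TotallyOrdered A → A ∈ Variety F) →
  (∀ A → A ∈ Variety E → A ∈ Variety F)

record Congruence {τ : Signature} (A : CRL τ ℓ) : Set (lsuc ℓ) where
  open CRL A
  field
    rel           : Rel Carrier ℓ
    isEquivalence : IsEquivalence rel
    reflexive     : ∀ {x y} → x ≈ y → rel x y
    ∧-compat      : Congruent₂ rel _∧_
    ∨-compat      : Congruent₂ rel _∨_
    ∙-compat      : Congruent₂ rel _∙_
    ⇨-compat      : Congruent₂ rel _⇨_

open Congruence public using (rel)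

-- The least congruence of A is its equality `_≈_`.

IsLeast : ∀ {τ} {A : CRL τ ℓ} → Congruence A → Set ℓ
IsLeast {A = A} Θ = rel Θ ≐ CRL._≈_ A

FinitelySubdirectlyIrreducible : ∀ {τ} → CRL τ ℓ → Set (lsuc ℓ)
FinitelySubdirectlyIrreducible A =
  ∀ n (Θ : Fin (suc n) → Congruence A) →
  (λ x y → ∀ i → rel (Θ i) x y) ≐ CRL._≈_ A →
  ∃[ i ] IsLeast (Θ i)

FSI : ∀ {τ} → Pred (CRL τ ℓ) k → Pred (CRL τ ℓ) (lsuc ℓ ⊔ k)
FSI K A = A ∈ K × FinitelySubdirectlyIrreducible A

record Embedding {τ : Signature} (A B : CRL τ ℓ) : Set ℓ where
  private
    module A = CRL A
    module B = CRL B
  open Morphism A.Carrier B.Carrier B._≈_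
  field
    ⟦_⟧        : A.Carrier → B.Carrier
    cong       : ⟦_⟧ Preserves A._≈_ ⟶ B._≈_
    injective  : Injective A._≈_ B._≈_ ⟦_⟧
    ∧-homo     : Homomorphic₂ ⟦_⟧ A._∧_ B._∧_
    ∨-homo     : Homomorphic₂ ⟦_⟧ A._∨_ B._∨_
    ∙-homo     : Homomorphic₂ ⟦_⟧ A._∙_ B._∙_
    ⇨-homo     : Homomorphic₂ ⟦_⟧ A._⇨_ B._⇨_
    ε-homo     : Homomorphic₀ ⟦_⟧ A.ε B.ε
    const-homo : ∀ c → Homomorphic₀ ⟦_⟧ (A.const c) (B.const c)

open Embedding public using (⟦_⟧)

module _ {τ : Signature} {A B : CRL τ ℓ} (φ : Embedding A B) where
  private
    module A = CRL A
    module B = CRL B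

  Image : Pred B.Carrier ℓ
  Image b = ∃[ a ] (⟦ φ ⟧ a B.≈ b)

  -- Restriction of a relation on B to the universe of the subalgebra φ[A].

  restrict : Rel B.Carrier ℓ → Rel (∃ Image) ℓ
  restrict R x y = R (proj₁ x) (proj₁ y)

  Essential : Set (lsuc ℓ)
  Essential = (Θ : Congruence B) →
    ¬ IsLeast Θ → ¬ (restrict (rel Θ) ≐ restrict B._≈_)

record Span {τ : Signature} (K : Pred (CRL τ ℓ) k) : Set (lsuc ℓ ⊔ k) where
  field
    {A B C} : CRL τ ℓ
    A∈K     : A ∈ K
    B∈K     : B ∈ K
    C∈K     : C ∈ K
    φ₁      : Embedding A B
    φ₂      : Embedding A C

record Amalgam {τ : Signature} {K : Pred (CRL τ ℓ) k} (S : Span K) :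
               Set (lsuc ℓ ⊔ k) where
  open Span S
  field
    {D}      : CRL τ ℓ
    D∈K      : D ∈ K
    ψ₁       : Embedding B D
    ψ₂       : Embedding C D
    commutes : ∀ a → CRL._≈_ D (⟦ ψ₁ ⟧ (⟦ φ₁ ⟧ a)) (⟦ ψ₂ ⟧ (⟦ φ₂ ⟧ a))

AmalgamationProperty : ∀ {τ} → Pred (CRL τ ℓ) k → Set (lsuc ℓ ⊔ k)
AmalgamationProperty K = (S : Span K) → Amalgam S

EssentialAmalgamationProperty : ∀ {τ} → Pred (CRL τ ℓ) k → Set (lsuc ℓ ⊔ k)
EssentialAmalgamationProperty K =
  (S : Span K) → Essential (Span.φ₂ S) → Amalgam S

{-# OPTIONS --safe #-}

-- From AP to EAP: amalgamate an essential span of FSI algebras in the variety,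
-- and divide the amalgam D by a congruence Ψ that is maximal among those
-- trivial on B.  Then B → D/Ψ is essential, so D/Ψ inherits finite subdirect
-- irreducibility from B; and C → D/Ψ stays injective because its kernel is
-- trivial on A and A → C is essential.
--
-- From EAP to AP: a subdirect product of amalgams of quotient spans is enough,
-- provided that they separate the points of B and C.  Given b ≉ b′ in B, take
-- Θ maximal among the congruences of B that omit (b, b′), so that B/Θ is FSI,
-- hence a chain by semilinearity, hence A/Θ is a chain and FSI.  By the
-- congruence extension property A/Θ embeds in a quotient of C, and dividing
-- further by a maximal congruence trivial on A/Θ makes this embedding
-- essential, so EAP amalgamates the quotient span.

module Submission where

open import Defs
open import Level using (Level; Lift; lift; lower) renaming (suc to lsuc)
open import Algebra.Bundles using (CommutativeMonoid)
open import Algebra.Core using (Op₂)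
open import Algebra.Lattice.Bundles using (Lattice)
import Algebra.Lattice.Properties.Lattice as LatticeProperties
import Algebra.Properties.CommutativeSemigroup as CommutativeSemigroupProperties
open import Algebra.Structures using (IsCommutativeMonoid)
open import Axiom.ExcludedMiddle using (ExcludedMiddle)
open import Data.Fin.Base using (Fin; zero; suc)
open import Data.Fin.Properties using (¬∀⟶∃¬)
open import Data.Nat.Base using (suc; zero)
open import Data.Product.Base using (∃; ∃-syntax; Σ-syntax; _×_; _,_; proj₁; proj₂)
open import Data.Sum.Base as Sum using (_⊎_; inj₁; inj₂)
open import Function.Base using (_∘_; id)
open import Function.Bundles using (_⇔_; mk⇔; Equivalence)
open import Relation.Binary.Bundles using (Poset)
open import Relation.Binary.Core using (Rel; _⇒_)
import Relation.Binary.Lattice.Structures as OrderTheoretic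
open import Relation.Binary.PropositionalEquality.Core as ≡ using (_≡_)
open import Relation.Binary.Structures using (IsEquivalence)
open import Relation.Nullary.Decidable
  using (map′; True; toWitness; fromWitness; decidable-stable)
open import Relation.Nullary.Negation.Core using (¬_)
open import Relation.Unary using (Pred; _∈_)

private variable
  ℓ : Level
  τ : Signature

-- Arithmetic of commutative residuated lattices.

module CRLProperties {ℓ : Level} {τ : Signature} (A : CRL τ ℓ) where
  open CRL A public
  open IsCommutativeMonoid isCommutativeMonoid public
    using (∙-cong) renaming (comm to ∙-comm; assoc to ∙-assoc; identityˡ to ∙-identityˡ)

  lattice : Lattice ℓ ℓ
  lattice = record { isLattice = isLattice }

  open Lattice lattice public
    using (∧-cong; ∨-cong; ∧-comm; ∨-comm; ∧-assoc; ∨-assoc; absorptive)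
    renaming (refl to ≈-refl; sym to ≈-sym; trans to ≈-trans)
  open OrderTheoretic.IsLattice
    (LatticeProperties.∨-∧-isOrderTheoreticLattice lattice) public
    using (x≤x∨y; y≤x∨y; ∨-least; x∧y≤x; x∧y≤y; ∧-greatest)
    renaming (refl to ≤-refl; trans to ≤-trans; antisym to ≤-antisym; reflexive to ≤-reflexive)

  commutativeMonoid : CommutativeMonoid ℓ ℓ
  commutativeMonoid = record { isCommutativeMonoid = isCommutativeMonoid }

  open CommutativeSemigroupProperties
    (CommutativeMonoid.commutativeSemigroup commutativeMonoid) public
    using (interchange; x∙yz≈y∙xz)

  curry-≤ : ∀ {x y z} → x ∙ y ≤ z → x ≤ y ⇨ z
  curry-≤ = Equivalence.to (residuation _ _ _)

  uncurry-≤ : ∀ {x y z} → x ≤ y ⇨ z → x ∙ y ≤ z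
  uncurry-≤ = Equivalence.from (residuation _ _ _)

  ⇨-eval : ∀ {x y} → (x ⇨ y) ∙ x ≤ y
  ⇨-eval = uncurry-≤ ≤-refl

  ⇨-monoʳ : ∀ {x y z} → y ≤ z → x ⇨ y ≤ x ⇨ z
  ⇨-monoʳ y≤z = curry-≤ (≤-trans ⇨-eval y≤z)

  ∙-monoˡ : ∀ {x y z} → x ≤ y → x ∙ z ≤ y ∙ z
  ∙-monoˡ x≤y = uncurry-≤ (≤-trans x≤y (curry-≤ ≤-refl))

  ∙-monoʳ : ∀ {x y z} → x ≤ y → z ∙ x ≤ z ∙ y
  ∙-monoʳ x≤y = ≤-trans (≤-reflexive (∙-comm _ _))
                  (≤-trans (∙-monoˡ x≤y) (≤-reflexive (∙-comm _ _)))

  ∙-mono : ∀ {x y u v} → x ≤ y → u ≤ v → x ∙ u ≤ y ∙ v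
  ∙-mono x≤y u≤v = ≤-trans (∙-monoˡ x≤y) (∙-monoʳ u≤v)

  ∨∙-least : ∀ {x y u z} → x ∙ u ≤ z → y ∙ u ≤ z → (x ∨ y) ∙ u ≤ z
  ∨∙-least p q = uncurry-≤ (∨-least (curry-≤ p) (curry-≤ q))

  ∙∨-least : ∀ {x y u z} → u ∙ x ≤ z → u ∙ y ≤ z → u ∙ (x ∨ y) ≤ z
  ∙∨-least p q = ≤-trans (≤-reflexive (∙-comm _ _))
    (∨∙-least (≤-trans (≤-reflexive (∙-comm _ _)) p) (≤-trans (≤-reflexive (∙-comm _ _)) q))

  ε∙-lower : ∀ {x} → ε ∙ x ≤ x
  ε∙-lower = ≤-reflexive (∙-identityˡ _)

  ∙-shrinkˡ : ∀ {s x} → s ≤ ε → s ∙ x ≤ x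
  ∙-shrinkˡ s≤ε = ≤-trans (∙-monoˡ s≤ε) ε∙-lower

  ∙-shrinkʳ : ∀ {s x} → s ≤ ε → x ∙ s ≤ x
  ∙-shrinkʳ s≤ε = ≤-trans (≤-reflexive (∙-comm _ _)) (∙-shrinkˡ s≤ε)

  -- The implication cut down to the negative cone. It equals `ε` exactly when `x ≤ y`, so
  -- inequalities and congruences can be tested on elements below `ε`.
  residual : Carrier → Carrier → Carrier
  residual x y = (x ⇨ y) ∧ ε

  residual≤ε : ∀ {x y} → residual x y ≤ ε
  residual≤ε = x∧y≤y _ _

  residual-eval : ∀ {x y} → residual x y ∙ x ≤ y
  residual-eval = ≤-trans (∙-monoˡ (x∧y≤x _ _)) ⇨-eval

  ε≤⇨ : ∀ {x y} → x ≤ y → ε ≤ x ⇨ y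
  ε≤⇨ x≤y = curry-≤ (≤-trans ε∙-lower x≤y)

  ε≤residual : ∀ {x y} → x ≤ y → ε ≤ residual x y
  ε≤residual x≤y = ∧-greatest (ε≤⇨ x≤y) ≤-refl

  ε≤residual⁻¹ : ∀ {x y} → ε ≤ residual x y → x ≤ y
  ε≤residual⁻¹ p = ≤-trans (≤-reflexive (≈-sym (∙-identityˡ _)))
                     (≤-trans (∙-monoˡ p) residual-eval)

-- Congruences and quotient algebras.

module CongruenceProperties {ℓ : Level} {τ : Signature} {A : CRL τ ℓ} (Θ : Congruence A) where
  open CRLProperties A
  open Congruence Θ public hiding (rel)
  open IsEquivalence isEquivalence public
    using () renaming (refl to Θ-refl; sym to Θ-sym; trans to Θ-trans)

  -- The conclusion is the order of the quotient, so an inequality in A for one representative of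
  -- the class of `x` is enough.
  ≤-below : ∀ {x p z} → rel Θ x p → p ≤ z → rel Θ x (x ∧ z)
  ≤-below xΘp p≤z = Θ-trans xΘp (Θ-trans (reflexive p≤z) (∧-compat (Θ-sym xΘp) Θ-refl))

  residual-Θ : ∀ {x y} → rel Θ x y → rel Θ (residual x y) ε
  residual-Θ {x} {y} xΘy = Θ-trans (∧-compat (⇨-compat Θ-refl (Θ-sym xΘy)) Θ-refl)
    (reflexive (≤-antisym residual≤ε (ε≤residual ≤-refl)))

infixl 9 _/_

_/_ : (A : CRL τ ℓ) → Congruence A → CRL τ ℓ
A / Θ = record
  { Carrier = Carrier
  ; _≈_ = rel Θ
  ; _∧_ = _∧_ ; _∨_ = _∨_ ; _∙_ = _∙_ ; _⇨_ = _⇨_ ; ε = ε ; const = const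
  ; isLattice = record
    { isEquivalence = isEquivalence
    ; ∨-comm  = λ x y → reflexive (∨-comm x y)
    ; ∨-assoc = λ x y z → reflexive (∨-assoc x y z)
    ; ∨-cong  = ∨-compat
    ; ∧-comm  = λ x y → reflexive (∧-comm x y)
    ; ∧-assoc = λ x y z → reflexive (∧-assoc x y z)
    ; ∧-cong  = ∧-compat
    ; absorptive = (λ x y → reflexive (proj₁ absorptive x y))
                 , (λ x y → reflexive (proj₂ absorptive x y))
    }
  ; isCommutativeMonoid = record
    { isMonoid = record
      { isSemigroup = record
        { isMagma = record { isEquivalence = isEquivalence ; ∙-cong = ∙-compat }
        ; assoc = λ x y z → reflexive (∙-assoc x y z)
        }
      ; identity = (λ x → reflexive (proj₁ identity x)) , (λ x → reflexive (proj₂ identity x))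
      }
    ; comm = λ x y → reflexive (∙-comm x y)
    }
  ; ⇨-cong = ⇨-compat
  ; residuation = λ x y z → mk⇔
      -- In both directions the left side is replaced by a congruent element for which the
      -- inequality holds in A: here `x` by `x ∧ (y ⇨ x ∙ y ∧ z)`, and in the converse `x ∙ y` by
      -- `(x ∧ (y ⇨ z)) ∙ y`.
      (λ p → ≤-below (Θ-trans (reflexive (curry-≤ ≤-refl)) (∧-compat Θ-refl (⇨-compat Θ-refl p)))
                     (≤-trans (x∧y≤y _ _) (⇨-monoʳ (x∧y≤y _ _))))
      (λ p → ≤-below (∙-compat p Θ-refl) (uncurry-≤ (x∧y≤y _ _)))
  }
  where
  open CRLProperties A
  open CongruenceProperties Θ
  open CommutativeMonoid commutativeMonoid using (identity)

module _ {A : CRL τ ℓ} where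
  open CRLProperties A

  Δ : Congruence A
  Δ = record
    { rel = _≈_
    ; isEquivalence = Lattice.isEquivalence lattice
    ; reflexive = id
    ; ∧-compat = ∧-cong ; ∨-compat = ∨-cong ; ∙-compat = ∙-cong ; ⇨-compat = ⇨-cong
    }

  -- The correspondence theorem: quotients keep the carrier and the operations, so only reflexivity
  -- has to be adjusted.
  collapse : (Θ : Congruence A) → Congruence (A / Θ) → Congruence A
  collapse Θ Ψ = record { Congruence Ψ ; reflexive = Ψ.reflexive ∘ Θ.reflexive }
    where
    module Θ = Congruence Θ
    module Ψ = Congruence Ψ

  collapse-embedding : (Θ : Congruence A) {Ψ : Congruence (A / Θ)} {D : CRL τ ℓ} →
                       Embedding (A / Θ / Ψ) D → Embedding (A / collapse Θ Ψ) D
  collapse-embedding Θ e = record { Embedding e }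

  eval-/ : (Θ : Congruence A) → ∀ ρ t → eval (A / Θ) ρ t ≡ eval A ρ t
  eval-/ Θ ρ (var n)    = ≡.refl
  eval-/ Θ ρ (s ∧ᵗ t)   = ≡.cong₂ _∧_ (eval-/ Θ ρ s) (eval-/ Θ ρ t)
  eval-/ Θ ρ (s ∨ᵗ t)   = ≡.cong₂ _∨_ (eval-/ Θ ρ s) (eval-/ Θ ρ t)
  eval-/ Θ ρ (s ∙ᵗ t)   = ≡.cong₂ _∙_ (eval-/ Θ ρ s) (eval-/ Θ ρ t)
  eval-/ Θ ρ (s ⇨ᵗ t)   = ≡.cong₂ _⇨_ (eval-/ Θ ρ s) (eval-/ Θ ρ t)
  eval-/ Θ ρ εᵗ         = ≡.refl
  eval-/ Θ ρ (constᵗ c) = ≡.refl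

  /-⊨ : (E : Theory τ ℓ) (Θ : Congruence A) → A ⊨ E → A / Θ ⊨ E
  /-⊨ E Θ A⊨E {s} {t} Est ρ =
    ≡.subst₂ (rel Θ) (≡.sym (eval-/ Θ ρ s)) (≡.sym (eval-/ Θ ρ t))
      (Congruence.reflexive Θ (A⊨E Est ρ))

-- Direct products and subdirect embeddings.

module _ {I : Set ℓ} (D : I → CRL τ ℓ) where
  private module D (i : I) = CRLProperties (D i)

  Π : CRL τ ℓ
  Π = record
    { Carrier = ∀ i → D.Carrier i
    ; _≈_ = λ x y → ∀ i → D._≈_ i (x i) (y i)
    ; _∧_ = λ x y i → D._∧_ i (x i) (y i)
    ; _∨_ = λ x y i → D._∨_ i (x i) (y i)
    ; _∙_ = λ x y i → D._∙_ i (x i) (y i)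
    ; _⇨_ = λ x y i → D._⇨_ i (x i) (y i)
    ; ε = λ i → D.ε i
    ; const = λ c i → D.const i c
    ; isLattice = record
      { isEquivalence = isEquivalence
      ; ∨-comm  = λ x y i → D.∨-comm i (x i) (y i)
      ; ∨-assoc = λ x y z i → D.∨-assoc i (x i) (y i) (z i)
      ; ∨-cong  = λ p q i → D.∨-cong i (p i) (q i)
      ; ∧-comm  = λ x y i → D.∧-comm i (x i) (y i)
      ; ∧-assoc = λ x y z i → D.∧-assoc i (x i) (y i) (z i)
      ; ∧-cong  = λ p q i → D.∧-cong i (p i) (q i)
      ; absorptive = (λ x y i → proj₁ (D.absorptive i) (x i) (y i))
                   , (λ x y i → proj₂ (D.absorptive i) (x i) (y i))
      }
    ; isCommutativeMonoid = record
      { isMonoid = record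
        { isSemigroup = record
          { isMagma = record
            { isEquivalence = isEquivalence ; ∙-cong = λ p q i → D.∙-cong i (p i) (q i) }
          ; assoc = λ x y z i → D.∙-assoc i (x i) (y i) (z i)
          }
        ; identity = (λ x i → CommutativeMonoid.identityˡ (D.commutativeMonoid i) (x i))
                   , (λ x i → CommutativeMonoid.identityʳ (D.commutativeMonoid i) (x i))
        }
      ; comm = λ x y i → D.∙-comm i (x i) (y i)
      }
    ; ⇨-cong = λ p q i → D.⇨-cong i (p i) (q i)
    ; residuation = λ x y z → mk⇔ (λ p i → D.curry-≤ i (p i)) (λ p i → D.uncurry-≤ i (p i))
    }
    where
    isEquivalence : IsEquivalence (λ (x y : ∀ i → D.Carrier i) → ∀ i → D._≈_ i (x i) (y i))
    isEquivalence = record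
      { refl  = λ i → D.≈-refl i
      ; sym   = λ p i → D.≈-sym i (p i)
      ; trans = λ p q i → D.≈-trans i (p i) (q i)
      }

  eval-Π : ∀ ρ t i → eval Π ρ t i ≡ eval (D i) (λ n → ρ n i) t
  eval-Π ρ (var n)    i = ≡.refl
  eval-Π ρ (s ∧ᵗ t)   i = ≡.cong₂ (D._∧_ i) (eval-Π ρ s i) (eval-Π ρ t i)
  eval-Π ρ (s ∨ᵗ t)   i = ≡.cong₂ (D._∨_ i) (eval-Π ρ s i) (eval-Π ρ t i)
  eval-Π ρ (s ∙ᵗ t)   i = ≡.cong₂ (D._∙_ i) (eval-Π ρ s i) (eval-Π ρ t i)
  eval-Π ρ (s ⇨ᵗ t)   i = ≡.cong₂ (D._⇨_ i) (eval-Π ρ s i) (eval-Π ρ t i)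
  eval-Π ρ εᵗ         i = ≡.refl
  eval-Π ρ (constᵗ c) i = ≡.refl

  Π-⊨ : (E : Theory τ ℓ) → (∀ i → D i ⊨ E) → Π ⊨ E
  Π-⊨ E D⊨E {s} {t} Est ρ i =
    ≡.subst₂ (D._≈_ i) (≡.sym (eval-Π ρ s i)) (≡.sym (eval-Π ρ t i))
      (D⊨E i Est (λ n → ρ n i))

  subdirect : {B : CRL τ ℓ} (Θ : I → Congruence B) → (∀ i → Embedding (B / Θ i) (D i)) →
              (∀ {x y} → (∀ i → rel (Θ i) x y) → CRL._≈_ B x y) → Embedding B Π
  subdirect Θ e separates = record
    { ⟦_⟧        = λ x i → ⟦ e i ⟧ x
    ; cong       = λ p i → cong (e i) (Congruence.reflexive (Θ i) p)
    ; injective  = λ p → separates (λ i → injective (e i) (p i))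
    ; ∧-homo     = λ x y i → ∧-homo (e i) x y
    ; ∨-homo     = λ x y i → ∨-homo (e i) x y
    ; ∙-homo     = λ x y i → ∙-homo (e i) x y
    ; ⇨-homo     = λ x y i → ⇨-homo (e i) x y
    ; ε-homo     = λ i → ε-homo (e i)
    ; const-homo = λ c i → const-homo (e i) c
    }
    where open Embedding

-- Embeddings, pullbacks of congruences and induced maps of quotients.

module _ {A C : CRL τ ℓ} (φ : Embedding A C) where
  private
    module A = CRLProperties A
    module C = CRLProperties C
    module φ = Embedding φ

  embedding-reflects-≤ : ∀ {x y} → ⟦ φ ⟧ x C.≤ ⟦ φ ⟧ y → x A.≤ y
  embedding-reflects-≤ p = φ.injective (C.≈-trans p (C.≈-sym (φ.∧-homo _ _)))

  embedding-mono-≤ : ∀ {x y} → x A.≤ y → ⟦ φ ⟧ x C.≤ ⟦ φ ⟧ y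
  embedding-mono-≤ p = C.≈-trans (φ.cong p) (φ.∧-homo _ _)

  embedding-totallyOrdered : TotallyOrdered C → TotallyOrdered A
  embedding-totallyOrdered total x y =
    Sum.map embedding-reflects-≤ embedding-reflects-≤ (total (⟦ φ ⟧ x) (⟦ φ ⟧ y))

  pullback : Congruence C → Congruence A
  pullback Φ = record
    { rel = λ x y → rel Φ (⟦ φ ⟧ x) (⟦ φ ⟧ y)
    ; isEquivalence = record { refl = Θ-refl ; sym = Θ-sym ; trans = Θ-trans }
    ; reflexive = reflexive ∘ φ.cong
    ; ∧-compat = conjugate φ.∧-homo ∧-compat
    ; ∨-compat = conjugate φ.∨-homo ∨-compat
    ; ∙-compat = conjugate φ.∙-homo ∙-compat
    ; ⇨-compat = conjugate φ.⇨-homo ⇨-compat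
    }
    where
    open CongruenceProperties Φ
    conjugate : {_·_ : Op₂ A.Carrier} {_∗_ : Op₂ C.Carrier} →
      (∀ x y → ⟦ φ ⟧ (x · y) C.≈ (⟦ φ ⟧ x ∗ ⟦ φ ⟧ y)) →
      (∀ {u u′ v v′} → rel Φ u u′ → rel Φ v v′ → rel Φ (u ∗ v) (u′ ∗ v′)) →
      ∀ {x x′ y y′} → rel Φ (⟦ φ ⟧ x) (⟦ φ ⟧ x′) → rel Φ (⟦ φ ⟧ y) (⟦ φ ⟧ y′) →
      rel Φ (⟦ φ ⟧ (x · y)) (⟦ φ ⟧ (x′ · y′))
    conjugate homo compat p q =
      Θ-trans (reflexive (homo _ _)) (Θ-trans (compat p q) (Θ-sym (reflexive (homo _ _))))

  /-embed-/ : (Θ : Congruence A) (Φ : Congruence C) →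
              (∀ {x y} → rel Θ x y → rel Φ (⟦ φ ⟧ x) (⟦ φ ⟧ y)) →
              (∀ {x y} → rel Φ (⟦ φ ⟧ x) (⟦ φ ⟧ y) → rel Θ x y) →
              Embedding (A / Θ) (C / Φ)
  /-embed-/ Θ Φ preserves reflects = record
    { ⟦_⟧ = ⟦ φ ⟧
    ; cong = preserves
    ; injective = reflects
    ; ∧-homo = λ x y → reflexive (φ.∧-homo x y)
    ; ∨-homo = λ x y → reflexive (φ.∨-homo x y)
    ; ∙-homo = λ x y → reflexive (φ.∙-homo x y)
    ; ⇨-homo = λ x y → reflexive (φ.⇨-homo x y)
    ; ε-homo = reflexive φ.ε-homo
    ; const-homo = λ c → reflexive (φ.const-homo c)
    }
    where open Congruence Φ using (reflexive)

  embed-/ : (Φ : Congruence C) → (∀ {x y} → rel Φ (⟦ φ ⟧ x) (⟦ φ ⟧ y) → x A.≈ y) →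
            Embedding A (C / Φ)
  embed-/ Φ trivial =
    record { Embedding (/-embed-/ Δ Φ (Congruence.reflexive Φ ∘ φ.cong) trivial) }

-- Congruences from submonoids of the negative cone

record NegativeSubmonoid (A : CRL τ ℓ) : Set (lsuc ℓ) where
  open CRL A
  field
    member   : Pred Carrier ℓ
    negative : ∀ {s} → s ∈ member → s ≤ ε
    ε-member : ε ∈ member
    ∙-member : ∀ {s t} → s ∈ member → t ∈ member → s ∙ t ∈ member

open NegativeSubmonoid

module _ {A : CRL τ ℓ} (S : NegativeSubmonoid A) where
  open CRLProperties A

  infix 4 _⊑_

  -- The order of the quotient in which the elements of S become `ε`. The submonoid acts as a base
  -- of a filter, and the inequality in the definition supplies convexity.
  _⊑_ : Rel Carrier ℓ
  x ⊑ y = ∃[ s ] (s ∈ member S × s ∙ x ≤ y)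

  private
    ≤⇒⊑ : ∀ {x y} → x ≤ y → x ⊑ y
    ≤⇒⊑ x≤y = ε , ε-member S , ≤-trans ε∙-lower x≤y

    ⊑-trans : ∀ {x y z} → x ⊑ y → y ⊑ z → x ⊑ z
    ⊑-trans (s , s∈ , p) (t , t∈ , q) = t ∙ s , ∙-member S t∈ s∈ ,
      ≤-trans (≤-reflexive (∙-assoc _ _ _)) (≤-trans (∙-monoʳ p) q)

    ∙-lowerˡ : ∀ {s t} → t ∈ member S → s ∙ t ≤ s
    ∙-lowerˡ t∈ = ∙-shrinkʳ (negative S t∈)

    ∙-lowerʳ : ∀ {s t} → s ∈ member S → s ∙ t ≤ t
    ∙-lowerʳ s∈ = ∙-shrinkˡ (negative S s∈)

    ⊑-∧ : ∀ {x x′ y y′} → x ⊑ x′ → y ⊑ y′ → x ∧ y ⊑ x′ ∧ y′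
    -- Both factors lie below `ε`, so `s ∙ t` is below `s` and below `t` and serves both
    -- inequalities at once.
    ⊑-∧ (s , s∈ , p) (t , t∈ , q) = s ∙ t , ∙-member S s∈ t∈ ,
      ∧-greatest (≤-trans (∙-mono (∙-lowerˡ t∈) (x∧y≤x _ _)) p)
                 (≤-trans (∙-mono (∙-lowerʳ s∈) (x∧y≤y _ _)) q)

    ⊑-∨ : ∀ {x x′ y y′} → x ⊑ x′ → y ⊑ y′ → x ∨ y ⊑ x′ ∨ y′
    ⊑-∨ (s , s∈ , p) (t , t∈ , q) = s ∙ t , ∙-member S s∈ t∈ ,
      ∙∨-least (≤-trans (∙-monoˡ (∙-lowerˡ t∈)) (≤-trans p (x≤x∨y _ _)))
               (≤-trans (∙-monoˡ (∙-lowerʳ s∈)) (≤-trans q (y≤x∨y _ _)))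

    ⊑-∙ : ∀ {x x′ y y′} → x ⊑ x′ → y ⊑ y′ → x ∙ y ⊑ x′ ∙ y′
    ⊑-∙ (s , s∈ , p) (t , t∈ , q) = s ∙ t , ∙-member S s∈ t∈ ,
      ≤-trans (≤-reflexive (interchange _ _ _ _)) (∙-mono p q)

    ⊑-⇨ : ∀ {x x′ y y′} → x′ ⊑ x → y ⊑ y′ → x ⇨ y ⊑ x′ ⇨ y′
    ⊑-⇨ (s , s∈ , p) (t , t∈ , q) = t ∙ s , ∙-member S t∈ s∈ ,
      -- The regrouping brings `s` next to `x′`: then `s ∙ x′ ≤ x` feeds the implication `x ⇨ y`,
      -- and `t` leads from `y` to `y′`.
      curry-≤ (≤-trans (≤-reflexive (≈-trans (∙-assoc _ _ _)
                                      (≈-trans (∙-assoc _ _ _)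
                                        (∙-cong ≈-refl (x∙yz≈y∙xz _ _ _)))))
              (≤-trans (∙-monoʳ (≤-trans (∙-monoʳ p) ⇨-eval)) q))

  submonoidCongruence : Congruence A
  submonoidCongruence = record
    { rel = λ x y → x ⊑ y × y ⊑ x
    ; isEquivalence = record
      { refl  = ≤⇒⊑ ≤-refl , ≤⇒⊑ ≤-refl
      ; sym   = λ (p , q) → q , p
      ; trans = λ (p , q) (p′ , q′) → ⊑-trans p p′ , ⊑-trans q′ q
      }
    ; reflexive = λ p → ≤⇒⊑ (≤-reflexive p) , ≤⇒⊑ (≤-reflexive (≈-sym p))
    ; ∧-compat = λ (p , q) (p′ , q′) → ⊑-∧ p p′ , ⊑-∧ q q′
    ; ∨-compat = λ (p , q) (p′ , q′) → ⊑-∨ p p′ , ⊑-∨ q q′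
    ; ∙-compat = λ (p , q) (p′ , q′) → ⊑-∙ p p′ , ⊑-∙ q q′
    ; ⇨-compat = λ (p , q) (p′ , q′) → ⊑-⇨ q p′ , ⊑-⇨ p q′
    }

  member-ε : ∀ {s} → s ∈ member S → rel submonoidCongruence s ε
  member-ε {s} s∈ = ≤⇒⊑ (negative S s∈) , (s , s∈ , ∙-shrinkʳ ≤-refl)

-- Congruence extension property

module _ {A C : CRL τ ℓ} (φ : Embedding A C) (Θ : Congruence A) where
  private
    module A = CRLProperties A
    module C = CRLProperties C
    module φ = Embedding φ
    open CongruenceProperties Θ

  -- The negative elements congruent to `ε` determine Θ through residuals, so their images are
  -- enough to generate its extension to C.
  imageSubmonoid : NegativeSubmonoid C
  imageSubmonoid = record
    { member   = λ c → ∃[ a ] (a A.≤ A.ε × rel Θ a A.ε × ⟦ φ ⟧ a C.≈ c)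
    ; negative = λ (a , a≤ε , _ , φa≈c) → C.≤-trans (C.≤-reflexive (C.≈-sym φa≈c))
        (C.≤-trans (embedding-mono-≤ φ a≤ε) (C.≤-reflexive φ.ε-homo))
    ; ε-member = A.ε , A.≤-refl , Θ-refl , φ.ε-homo
    ; ∙-member = λ (a , a≤ε , aΘε , p) (b , b≤ε , bΘε , q) →
        a A.∙ b , A.≤-trans (A.∙-shrinkˡ a≤ε) b≤ε ,
        Θ-trans (∙-compat aΘε bΘε) (reflexive (A.∙-identityˡ _)) ,
        C.≈-trans (φ.∙-homo a b) (C.∙-cong p q)
    }

  extension : Congruence C
  extension = submonoidCongruence imageSubmonoid

  private
    preserves : ∀ {x y} → rel Θ x y → _⊑_ imageSubmonoid (⟦ φ ⟧ x) (⟦ φ ⟧ y)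
    preserves {x} {y} xΘy = ⟦ φ ⟧ r , (r , A.residual≤ε , residual-Θ xΘy , C.≈-refl) ,
      C.≤-trans (C.≤-reflexive (C.≈-sym (φ.∙-homo _ _))) (embedding-mono-≤ φ A.residual-eval)
      where r = A.residual x y

    -- The witness comes from some `a` in A, so `a ∙ x ≤ y` already holds in A, and modulo Θ the
    -- factor `a` is `ε`.
    reflects : ∀ {x y} → _⊑_ imageSubmonoid (⟦ φ ⟧ x) (⟦ φ ⟧ y) → rel Θ x (x A.∧ y)
    reflects {x} (c , (a , _ , aΘε , φa≈c) , c∙φx≤φy) =
      ≤-below (Θ-trans (reflexive (A.≈-sym (A.∙-identityˡ x))) (∙-compat (Θ-sym aΘε) Θ-refl))
        (embedding-reflects-≤ φ (C.≤-trans
          (C.≤-reflexive (C.≈-trans (φ.∙-homo a x) (C.∙-cong φa≈c C.≈-refl))) c∙φx≤φy))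

  extension-embedding : Embedding (A / Θ) (C / extension)
  extension-embedding = /-embed-/ φ Θ extension
    (λ p → preserves p , preserves (Θ-sym p))
    (λ (p , q) → CRLProperties.≤-antisym (A / Θ) (reflects p) (reflects q))

-- Finitely subdirectly irreducible algebras and chains

module _ {A : CRL τ ℓ} where
  open CRLProperties A

  -- The orthogonal complement of X in the negative cone, where `s` and `x` are orthogonal when
  -- their join is `ε`.
  polar : Pred Carrier ℓ → NegativeSubmonoid A
  polar X = record
    { member   = λ s → s ≤ ε × (∀ {x} → x ∈ X → x ≤ ε → ε ≤ s ∨ x)
    ; negative = proj₁
    ; ε-member = ≤-refl , λ _ _ → x≤x∨y _ _
    -- From `ε ≤ s ∨ x` follows `t ≤ (s ∨ x) ∙ t ≤ s ∙ t ∨ x`; this bounds `t` in `ε ≤ t ∨ x`.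
    ; ∙-member = λ {s} {t} (s≤ε , s⊥) (t≤ε , t⊥) → ≤-trans (∙-shrinkˡ s≤ε) t≤ε , λ x∈X x≤ε →
        ≤-trans (t⊥ x∈X x≤ε) (∨-least
          (≤-trans (≤-reflexive (≈-sym (∙-identityˡ t)))
            (≤-trans (∙-monoˡ (s⊥ x∈X x≤ε))
              (∨∙-least (x≤x∨y _ _) (≤-trans (∙-shrinkʳ t≤ε) (y≤x∨y _ _)))))
          (y≤x∨y _ _))
    }

  -- With r = residual x y and r′ = residual y x, the polars T = {r}⊥ ∋ r′ and
  -- S = T⊥ ∋ r define congruences that meet trivially, since s ∨ t = ε on S × T.
  prelinear∧FSI⇒total : (∀ x y → ε ≤ residual x y ∨ residual y x) →
                        FinitelySubdirectlyIrreducible A → TotallyOrdered A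
  prelinear∧FSI⇒total prelinear fsi x y = conclude (fsi 1 Θ (⋂⊆≈ , ≈⊆⋂))
    where
    S T : NegativeSubmonoid A
    T = polar (_≡ residual x y)
    S = polar (member T)

    Θ : Fin 2 → Congruence A
    Θ zero    = submonoidCongruence S
    Θ (suc _) = submonoidCongruence T

    ⊑-meet : ∀ {u v} → _⊑_ S u v → _⊑_ T u v → u ≤ v
    ⊑-meet (s , (_ , s⊥) , p) (t , t∈ , q) = ≤-trans (≤-reflexive (≈-sym (∙-identityˡ _)))
      (≤-trans (∙-monoˡ (s⊥ t∈ (proj₁ t∈))) (∨∙-least p q))

    ⋂⊆≈ : ∀ {u v} → (∀ i → rel (Θ i) u v) → u ≈ v
    ⋂⊆≈ p = ≤-antisym (⊑-meet (proj₁ (p zero)) (proj₁ (p (suc zero))))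
                      (⊑-meet (proj₂ (p zero)) (proj₂ (p (suc zero))))

    ≈⊆⋂ : ∀ {u v} → u ≈ v → ∀ i → rel (Θ i) u v
    ≈⊆⋂ p i = Congruence.reflexive (Θ i) p

    xy∈S : residual x y ∈ member S
    xy∈S = residual≤ε , λ (_ , t⊥) _ →
      ≤-trans (t⊥ ≡.refl residual≤ε) (≤-reflexive (∨-comm _ _))

    yx∈T : residual y x ∈ member T
    yx∈T = residual≤ε , λ { ≡.refl _ → prelinear y x }

    -- Whichever congruence is least, the residual in its submonoid is congruent to `ε` and hence
    -- equal to it, which is one of the two inequalities.
    conclude : ∃[ i ] IsLeast (Θ i) → x ≤ y ⊎ y ≤ x
    conclude (zero , leastS , _) =
      inj₁ (ε≤residual⁻¹ (≤-reflexive (≈-sym (leastS (member-ε S xy∈S)))))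
    conclude (suc zero , leastT , _) =
      inj₂ (ε≤residual⁻¹ (≤-reflexive (≈-sym (leastT (member-ε T yx∈T)))))

prelinearity : Theory τ ℓ
prelinearity s t = Lift _ (s ≡ (((var 0 ⇨ᵗ var 1) ∧ᵗ εᵗ) ∨ᵗ ((var 1 ⇨ᵗ var 0) ∧ᵗ εᵗ)) × t ≡ εᵗ)

total⇒prelinear : (A : CRL τ ℓ) → TotallyOrdered A → A ⊨ prelinearity
total⇒prelinear A total (lift (≡.refl , ≡.refl)) ρ =
  ≤-antisym (∨-least residual≤ε residual≤ε)
    (Sum.[ (λ p → ≤-trans (ε≤residual p) (x≤x∨y _ _))
         , (λ p → ≤-trans (ε≤residual p) (y≤x∨y _ _)) ] (total (ρ 0) (ρ 1)))
  where open CRLProperties A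

-- Chains satisfy `prelinearity`, so semilinearity, applied to this one-equation theory, carries it
-- to the whole variety.
FSI⇒total : {E : Theory τ ℓ} → Semilinear E →
            (A : CRL τ ℓ) → A ∈ FSI (Variety E) → TotallyOrdered A
FSI⇒total semilinear A (A⊨E , fsi) = prelinear∧FSI⇒total
  (λ x y → ≤-reflexive (≈-sym
    (semilinear prelinearity (λ B _ → total⇒prelinear B) A A⊨E
      -- Only variables 0 and 1 occur in the equation; all later variables get the default `y`.
      (lift (≡.refl , ≡.refl)) λ { zero → x ; (suc _) → y })))
  fsi
  where open CRLProperties A

-- A single pair as a relation, so that keeping two points apart becomes an instance of `Avoids`.
Pair : {X : Set ℓ} → X → X → Rel X ℓ
Pair b b′ x y = x ≡ b × y ≡ b′

-- Chains and essential embeddings, with excluded middle.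

module Classical {ℓ : Level} (em : ExcludedMiddle (lsuc ℓ)) where

  em₀ : ExcludedMiddle ℓ
  em₀ = map′ lower lift em

  module _ {τ : Signature} (A : CRL τ ℓ) (total : TotallyOrdered A) where
    open CRLProperties A

    private
      -- Otherwise the residuals of every congruent pair, being congruent to `ε`, would lie above
      -- `ε`, and Θ would be the equality.
      nontrivial : (Θ : Congruence A) → ¬ IsLeast Θ →
                   ∃[ c ] (c ≤ ε × ¬ (ε ≤ c) × rel Θ c ε)
      nontrivial Θ ¬least = decidable-stable em₀ λ none → ¬least
        ( (λ xΘy → ≤-antisym (below none xΘy) (below none (Θ-sym xΘy))) , reflexive )
        where
        open CongruenceProperties Θ
        below : ¬ (∃[ c ] (c ≤ ε × ¬ (ε ≤ c) × rel Θ c ε)) → ∀ {x y} → rel Θ x y → x ≤ y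
        below none xΘy = ε≤residual⁻¹ (decidable-stable em₀ λ ε≰ →
          none (_ , residual≤ε , ε≰ , residual-Θ xΘy))

      Θ-convex : (Θ : Congruence A) → ∀ {c d} → c ≤ d → d ≤ ε → rel Θ c ε → rel Θ d ε
      Θ-convex Θ c≤d d≤ε cΘε =
        Θ-trans (reflexive (≤-antisym (y≤x∨y _ _) (∨-least c≤d ≤-refl)))
          (Θ-trans (∨-compat cΘε Θ-refl)
            (reflexive (≤-antisym (∨-least ≤-refl d≤ε) (x≤x∨y _ _))))
        where open CongruenceProperties Θ

      -- Of two witnesses in a chain the larger one works for both, since classes of `ε` are convex
      -- below `ε`.
      common : ∀ n (Θ : Fin (suc n) → Congruence A) → (∀ i → ¬ IsLeast (Θ i)) →
               ∃[ c ] (c ≤ ε × ¬ (ε ≤ c) × ∀ i → rel (Θ i) c ε)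
      common zero Θ ¬least with nontrivial (Θ zero) (¬least zero)
      ... | c , c≤ε , ε≰c , cΘε = c , c≤ε , ε≰c , λ { zero → cΘε }
      common (suc n) Θ ¬least
        with nontrivial (Θ zero) (¬least zero) | common n (Θ ∘ suc) (¬least ∘ suc)
      ... | c , c≤ε , ε≰c , cΘε | d , d≤ε , ε≰d , dΘε with total c d
      ... | inj₁ c≤d = d , d≤ε , ε≰d ,
        λ { zero → Θ-convex (Θ zero) c≤d d≤ε cΘε ; (suc i) → dΘε i }
      ... | inj₂ d≤c = c , c≤ε , ε≰c ,
        λ { zero → cΘε ; (suc i) → Θ-convex (Θ (suc i)) d≤c c≤ε (dΘε i) }

    total⇒FSI : FinitelySubdirectlyIrreducible A
    total⇒FSI n Θ (⋂⊆≈ , _) = decidable-stable em₀ λ none →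
      let (c , _ , ε≰c , cΘε) = common n Θ (λ i least → none (i , least))
      in ε≰c (≤-reflexive (≈-sym (⋂⊆≈ cΘε)))

  module _ {τ : Signature} {A C : CRL τ ℓ} (φ : Embedding A C) (essential : Essential φ) where
    private
      module A = CRLProperties A
      module C = CRLProperties C
      module φ = Embedding φ

    -- Essentiality in contrapositive form, with the restriction to the image expressed through
    -- elements of A.
    essential-least : (Θ : Congruence C) → (∀ {x y} → rel Θ (⟦ φ ⟧ x) (⟦ φ ⟧ y) → x A.≈ y) →
                      IsLeast Θ
    essential-least Θ trivial = decidable-stable em₀ λ ¬least → essential Θ ¬least
      ( (λ {(_ , _ , p)} {(_ , _ , q)} xΘy → C.≈-trans (C.≈-sym p) (C.≈-trans
          (φ.cong (trivial (Θ-trans (reflexive p) (Θ-trans xΘy (Θ-sym (reflexive q)))))) q))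
      , reflexive )
      where open CongruenceProperties Θ

    -- The pullbacks to A meet in the least congruence, so one of them is least, and essentiality
    -- lifts this to C.
    essential-FSI : FinitelySubdirectlyIrreducible A → FinitelySubdirectlyIrreducible C
    essential-FSI fsi n Θ (⋂⊆≈ , _) =
      let (i , least , _) = fsi n (pullback φ ∘ Θ)
            ( (λ p → φ.injective (⋂⊆≈ p))
            , (λ p i → Congruence.reflexive (Θ i) (φ.cong p)) )
      in i , essential-least (Θ i) least

  -- Excluded middle makes Set (lsuc ℓ) propositions equivalent to Set ℓ ones:
  -- a union of congruences is quantified over Set (lsuc ℓ), but must have
  -- values in Set ℓ.
  record Small (P : Set (lsuc ℓ)) : Set ℓ where
    constructor small
    field holds : True (em {P})

  shrink : {P : Set (lsuc ℓ)} → P → Small P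
  shrink p = small (fromWitness p)

  unshrink : {P : Set (lsuc ℓ)} → Small P → P
  unshrink (small p) = toWitness p

  -- Unions of chains of congruences.

  module _ {τ : Signature} {A : CRL τ ℓ} (𝒞 : Pred (Congruence A) (lsuc ℓ))
           (inhabited : ∃[ Θ ] Θ ∈ 𝒞)
           (chain : ∀ {Θ Ψ} → Θ ∈ 𝒞 → Ψ ∈ 𝒞 → rel Θ ⇒ rel Ψ ⊎ rel Ψ ⇒ rel Θ) where
    open CRL A

    private
      Joined : Rel Carrier (lsuc ℓ)
      Joined x y = ∃[ Θ ] (Θ ∈ 𝒞 × rel Θ x y)

      -- The larger of two members of the chain contains both pairs; this makes the union transitive
      -- and compatible with the operations.
      both : ∀ {x x′ y y′} → Joined x x′ → Joined y y′ →
             ∃[ Θ ] (Θ ∈ 𝒞 × rel Θ x x′ × rel Θ y y′)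
      both (Θ , Θ∈ , p) (Ψ , Ψ∈ , q) with chain Θ∈ Ψ∈
      ... | inj₁ Θ⊆Ψ = Ψ , Ψ∈ , Θ⊆Ψ p , q
      ... | inj₂ Ψ⊆Θ = Θ , Θ∈ , p , Ψ⊆Θ q

      map₂ : ∀ {x x′ y y′ z z′} →
             ((Θ : Congruence A) → rel Θ x x′ → rel Θ y y′ → rel Θ z z′) →
             Small (Joined x x′) → Small (Joined y y′) → Small (Joined z z′)
      map₂ f p q = let (Θ , Θ∈ , p′ , q′) = both (unshrink p) (unshrink q)
                   in shrink (Θ , Θ∈ , f Θ p′ q′)

      Joined-reflexive : ∀ {x y} → x ≈ y → Small (Joined x y)
      Joined-reflexive p =
        let (Θ , Θ∈) = inhabited in shrink (Θ , Θ∈ , Congruence.reflexive Θ p)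

    ⋃ : Congruence A
    ⋃ = record
      { rel = λ x y → Small (Joined x y)
      ; isEquivalence = record
        { refl  = Joined-reflexive (CRLProperties.≈-refl A)
        ; sym   = λ p → map₂ (λ Θ q _ → CongruenceProperties.Θ-sym Θ q) p p
        ; trans = map₂ (λ Θ → CongruenceProperties.Θ-trans Θ)
        }
      ; reflexive = Joined-reflexive
      ; ∧-compat = map₂ (λ Θ → Congruence.∧-compat Θ)
      ; ∨-compat = map₂ (λ Θ → Congruence.∨-compat Θ)
      ; ∙-compat = map₂ (λ Θ → Congruence.∙-compat Θ)
      ; ⇨-compat = map₂ (λ Θ → Congruence.⇨-compat Θ)
      }

    ⋃-upper : ∀ {Θ} → Θ ∈ 𝒞 → rel Θ ⇒ rel ⋃
    ⋃-upper Θ∈ p = shrink (_ , Θ∈ , p)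

    ⋃-member : ∀ {x y} → rel ⋃ x y → Joined x y
    ⋃-member = unshrink

  -- Maximal congruences by Zorn's lemma.

  module _ {τ : Signature} {A : CRL τ ℓ} where
    open CRL A

    Avoids : Rel Carrier ℓ → Congruence A → Set ℓ
    Avoids R Θ = ∀ {x y} → R x y → ¬ rel Θ x y

    MaximalAvoiding : Rel Carrier ℓ → Congruence A → Set (lsuc ℓ)
    MaximalAvoiding R Θ = Avoids R Θ × (∀ Ψ → Avoids R Ψ → rel Θ ⇒ rel Ψ → rel Ψ ⇒ rel Θ)

    -- A pair in the union of a chain already lies in one member, so the union of a chain of
    -- avoiding congruences still avoids R.
    maximalAvoiding : ZornsLemma (lsuc ℓ) → (R : Rel Carrier ℓ) → Avoids R Δ →
                      ∃ (MaximalAvoiding R)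
    maximalAvoiding zorn R avoidsΔ =
      let ((Θ , avoids) , maximal) = zorn P bound
      in Θ , avoids , λ Ψ Ψ-avoids Θ⊆Ψ → proj₁ (lower (maximal {Ψ , Ψ-avoids} (lift Θ⊆Ψ)))
      where
      P : Poset (lsuc ℓ) (lsuc ℓ) (lsuc ℓ)
      P = record
        { Carrier = ∃ (Avoids R)
        ; _≈_ = λ (Θ , _) (Ψ , _) → Lift (lsuc ℓ) (rel Θ ⇒ rel Ψ × rel Ψ ⇒ rel Θ)
        ; _≤_ = λ (Θ , _) (Ψ , _) → Lift (lsuc ℓ) (rel Θ ⇒ rel Ψ)
        ; isPartialOrder = record
          { isPreorder = record
            { isEquivalence = record
              { refl  = lift (id , id)
              ; sym   = λ (lift (p , q)) → lift (q , p)
              ; trans = λ (lift (p , q)) (lift (p′ , q′)) → lift (p′ ∘ p , q ∘ q′)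
              }
            ; reflexive = λ (lift (p , _)) → lift p
            ; trans = λ (lift p) (lift q) → lift (q ∘ p)
            }
          ; antisym = λ (lift p) (lift q) → lift (p , q)
          }
        }

      open Poset P using () renaming (_≤_ to _⊆_)

      bound : ∀ (C : Pred (∃ (Avoids R)) (lsuc ℓ)) →
              (∀ {x y} → x ∈ C → y ∈ C → x ⊆ y ⊎ y ⊆ x) →
              ∃[ u ] (∀ {x} → x ∈ C → x ⊆ u)
      bound C chain = (⋃ 𝒞 inhabited 𝒞-chain , avoids) ,
        λ {(_ , Θ-avoids)} Θ∈C → lift (⋃-upper 𝒞 inhabited 𝒞-chain (inj₂ (Θ-avoids , Θ∈C)))
        where
        -- Adding the least congruence makes the chain nonempty.
        𝒞 : Pred (Congruence A) (lsuc ℓ)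
        𝒞 Θ = Θ ≡ Δ ⊎ Σ[ Θ-avoids ∈ Avoids R Θ ] (Θ , λ {x} {y} → Θ-avoids {x} {y}) ∈ C

        inhabited : ∃[ Θ ] Θ ∈ 𝒞
        inhabited = Δ , inj₁ ≡.refl

        𝒞-chain : ∀ {Θ Ψ} → Θ ∈ 𝒞 → Ψ ∈ 𝒞 → rel Θ ⇒ rel Ψ ⊎ rel Ψ ⇒ rel Θ
        𝒞-chain {Ψ = Ψ} (inj₁ ≡.refl) _ = inj₁ (Congruence.reflexive Ψ)
        𝒞-chain {Θ = Θ} _ (inj₁ ≡.refl) = inj₂ (Congruence.reflexive Θ)
        𝒞-chain (inj₂ (_ , Θ∈C)) (inj₂ (_ , Ψ∈C)) = Sum.map lower lower (chain Θ∈C Ψ∈C)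

        avoids : Avoids R (⋃ 𝒞 inhabited 𝒞-chain)
        avoids Rxy p with ⋃-member 𝒞 inhabited 𝒞-chain p
        ... | _ , inj₁ ≡.refl , x≈y = avoidsΔ Rxy x≈y
        ... | _ , inj₂ (Θ-avoids , _) , xΘy = Θ-avoids Rxy xΘy

    -- Among finitely many congruences meeting in the least one, some member keeps `b` and `b′`
    -- apart; seen as a congruence of A it contains Θ, so maximality makes it equal to Θ.
    maximalAvoidingPair-FSI : ∀ {b b′} Θ → MaximalAvoiding (Pair b b′) Θ →
                              FinitelySubdirectlyIrreducible (A / Θ)
    maximalAvoidingPair-FSI {b} {b′} Θ (avoids , maximal) n Ψ (⋂⊆Θ , _) =
      let (i , ¬bΨb′) = ¬∀⟶∃¬ _ (λ i → rel (Ψ i) b b′) (λ _ → em₀)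
                          (λ p → avoids (≡.refl , ≡.refl) (⋂⊆Θ p))
      in i , maximal (collapse Θ (Ψ i)) (λ { (≡.refl , ≡.refl) → ¬bΨb′ })
               (Congruence.reflexive (Ψ i))
           , Congruence.reflexive (Ψ i)

  module _ (zorn : ZornsLemma (lsuc ℓ)) where

    -- Φ is maximal among congruences identifying no distinct points of the image. A congruence of
    -- `C / Φ` trivial on A collapses to another such congruence above Φ, hence to Φ.
    essentialQuotient : {τ : Signature} {A C : CRL τ ℓ} → Embedding A C →
                        ∃[ Φ ] (Σ[ e ∈ Embedding A (C / Φ) ] Essential e)
    essentialQuotient {A = A} {C} φ =
      let (Φ , avoids , maximal) = maximalAvoiding zorn Distinct
            (λ { (_ , _ , ≉ , ≡.refl , ≡.refl) p → ≉ (φ.injective p) })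
      in Φ
       , embed-/ φ Φ (λ p → decidable-stable em₀ λ ≉ → avoids (_ , _ , ≉ , ≡.refl , ≡.refl) p)
       , λ Ψ ¬least (Ψ⊆Φ , _) → ¬least
           ( maximal (collapse Φ Ψ)
               (λ { (a , a′ , ≉ , ≡.refl , ≡.refl) p →
                    avoids (a , a′ , ≉ , ≡.refl , ≡.refl)
                      (Ψ⊆Φ {_ , a , CongruenceProperties.Θ-refl Φ}
                           {_ , a′ , CongruenceProperties.Θ-refl Φ} p) })
               (Congruence.reflexive Ψ)
           , Congruence.reflexive Ψ )
      where
      module A = CRL A
      module φ = Embedding φ
      Distinct : Rel (CRL.Carrier C) ℓ
      Distinct x y = ∃[ a ] ∃[ a′ ] (¬ (a A.≈ a′) × ⟦ φ ⟧ a ≡ x × ⟦ φ ⟧ a′ ≡ y)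

    -- Transfer of amalgamation between the variety and its finitely subdirectly irreducible
    -- members.

    module _ {τ : Signature} (E : Theory τ ℓ) where

      AP⇒EAP : AmalgamationProperty (Variety E) →
               EssentialAmalgamationProperty (FSI (Variety E))
      AP⇒EAP ap S essential =
        let (Ψ , ψ₁ , ψ₁-essential) = essentialQuotient 𝒜.ψ₁
            open CongruenceProperties Ψ
            -- By commutativity the kernel of C → D/Ψ restricts on A to the kernel of A → B → D/Ψ, a
            -- composite of embeddings.
            ψ₂ = embed-/ 𝒜.ψ₂ Ψ (proj₁ (essential-least φ₂ essential (pullback 𝒜.ψ₂ Ψ) λ p →
                   φ₁.injective (Embedding.injective ψ₁ (Θ-trans (reflexive (𝒜.commutes _))
                     (Θ-trans p (Θ-sym (reflexive (𝒜.commutes _))))))))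
        in record
        { D∈K = /-⊨ E Ψ 𝒜.D∈K , essential-FSI ψ₁ ψ₁-essential (proj₂ B∈K)
        ; ψ₁ = ψ₁
        ; ψ₂ = ψ₂
        ; commutes = λ a → reflexive (𝒜.commutes a)
        }
        where
        open Span S
        module φ₁ = Embedding φ₁
        V-span : Span (Variety E)
        V-span = record
          { A∈K = proj₁ A∈K ; B∈K = proj₁ B∈K ; C∈K = proj₁ C∈K ; φ₁ = φ₁ ; φ₂ = φ₂ }
        module 𝒜 = Amalgam (ap V-span)

      -- Only quotients of B and C are embedded, but commutativity is kept on all of A, so that
      -- families of these assemble into a product.
      record PartialAmalgam (S : Span (Variety E)) : Set (lsuc ℓ) where
        open Span S
        field
          {D}      : CRL τ ℓ
          D∈V      : D ∈ Variety E
          Θ₁       : Congruence B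
          Θ₂       : Congruence C
          ψ₁       : Embedding (B / Θ₁) D
          ψ₂       : Embedding (C / Θ₂) D
          commutes : ∀ a → CRL._≈_ D (⟦ ψ₁ ⟧ (⟦ φ₁ ⟧ a)) (⟦ ψ₂ ⟧ (⟦ φ₂ ⟧ a))

      open PartialAmalgam using (Θ₁; Θ₂)

      -- Points of B are separated directly; the swapped span does the same for points of C.
      swap : Span (Variety E) → Span (Variety E)
      swap S = record { A∈K = A∈K ; B∈K = C∈K ; C∈K = B∈K ; φ₁ = φ₂ ; φ₂ = φ₁ }
        where open Span S

      swap-amalgam : {S : Span (Variety E)} → PartialAmalgam (swap S) → PartialAmalgam S
      swap-amalgam 𝒜 = record
        { D∈V = D∈V ; Θ₁ = Θ₂ 𝒜 ; Θ₂ = Θ₁ 𝒜 ; ψ₁ = ψ₂ ; ψ₂ = ψ₁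
        ; commutes = λ a → CRLProperties.≈-sym D (commutes a)
        }
        where open PartialAmalgam 𝒜 hiding (Θ₁; Θ₂)

      module _ (semilinear : Semilinear E)
               (eap : EssentialAmalgamationProperty (FSI (Variety E))) where

        module _ (S : Span (Variety E)) where
          open Span S

          amalgamateQuotients : (Θ : Congruence B) → FinitelySubdirectlyIrreducible (B / Θ) →
                                Σ[ 𝒜 ∈ PartialAmalgam S ] (rel (Θ₁ 𝒜) ⇒ rel Θ)
          amalgamateQuotients Θ B/Θ-fsi = partial , id
            where
            Θₐ : Congruence A
            Θₐ = pullback φ₁ Θ

            χ₁ : Embedding (A / Θₐ) (B / Θ)
            χ₁ = /-embed-/ φ₁ Θₐ Θ id id

            A/Θ-fsi : FinitelySubdirectlyIrreducible (A / Θₐ)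
            -- Total order is the property that passes from `B / Θ` to its subalgebra.
            A/Θ-fsi = total⇒FSI (A / Θₐ) (embedding-totallyOrdered χ₁
              (FSI⇒total semilinear (B / Θ) (/-⊨ E Θ B∈K , B/Θ-fsi)))

            quotient : ∃[ Ψ ] (Σ[ e ∈ Embedding (A / Θₐ) (C / extension φ₂ Θₐ / Ψ) ] Essential e)
            quotient = essentialQuotient {A = A / Θₐ} {C / extension φ₂ Θₐ}
              (extension-embedding φ₂ Θₐ)

            Ψ : Congruence (C / extension φ₂ Θₐ)
            Ψ = proj₁ quotient

            χ₂ : Embedding (A / Θₐ) (C / extension φ₂ Θₐ / Ψ)
            χ₂ = proj₁ (proj₂ quotient)

            χ₂-essential : Essential χ₂
            χ₂-essential = proj₂ (proj₂ quotient)

            quotientSpan : Span (FSI (Variety E))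
            quotientSpan = record
              { A∈K = /-⊨ E Θₐ A∈K , A/Θ-fsi
              ; B∈K = /-⊨ E Θ B∈K , B/Θ-fsi
              ; C∈K = /-⊨ E Ψ (/-⊨ E (extension φ₂ Θₐ) C∈K) , essential-FSI χ₂ χ₂-essential A/Θ-fsi
              ; φ₁ = χ₁
              ; φ₂ = χ₂
              }

            module 𝒜 = Amalgam (eap quotientSpan χ₂-essential)

            partial : PartialAmalgam S
            partial = record
              { D∈V = proj₁ 𝒜.D∈K
              ; Θ₁ = Θ
              ; Θ₂ = collapse (extension φ₂ Θₐ) Ψ
              ; ψ₁ = 𝒜.ψ₁
              ; ψ₂ = collapse-embedding (extension φ₂ Θₐ) {Ψ} 𝒜.ψ₂
              ; commutes = 𝒜.commutes
              }

          separate : ∀ {b b′} → ¬ CRL._≈_ B b b′ →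
                     Σ[ 𝒜 ∈ PartialAmalgam S ] (¬ rel (Θ₁ 𝒜) b b′)
          separate {b} {b′} b≉b′ =
            let (Θ , Θ-maximal) = maximalAvoiding {A = B} zorn (Pair b b′)
                  λ { (≡.refl , ≡.refl) → b≉b′ }
                (𝒜 , Θ₁⊆Θ) = amalgamateQuotients Θ (maximalAvoidingPair-FSI Θ Θ-maximal)
            in 𝒜 , λ bΘ₁b′ → proj₁ Θ-maximal (≡.refl , ≡.refl) (Θ₁⊆Θ bΘ₁b′)

        EAP⇒AP : AmalgamationProperty (Variety E)
        EAP⇒AP S = record
          { D∈K = Π-⊨ 𝒟 E (λ i → PartialAmalgam.D∈V (𝒜 i))
          ; ψ₁ = subdirect 𝒟 (Θ₁ ∘ 𝒜) (λ i → PartialAmalgam.ψ₁ (𝒜 i))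
              -- Two distinct points index a factor that keeps them apart. If B and C are both
              -- trivial, there are no factors and the product is trivial too.
              (λ p → decidable-stable em₀ λ ≉ → proj₂ (separate S ≉) (p (inj₁ (_ , _ , ≉))))
          ; ψ₂ = subdirect 𝒟 (Θ₂ ∘ 𝒜) (λ i → PartialAmalgam.ψ₂ (𝒜 i))
              (λ p → decidable-stable em₀ λ ≉ → proj₂ (separate (swap S) ≉) (p (inj₂ (_ , _ , ≉))))
          ; commutes = λ a i → PartialAmalgam.commutes (𝒜 i) a
          }
          where
          open Span S
          Distinct : CRL τ ℓ → Set ℓ
          Distinct X = ∃[ x ] ∃[ y ] ¬ CRL._≈_ X x y

          𝒜 : Distinct B ⊎ Distinct C → PartialAmalgam S
          𝒜 (inj₁ (_ , _ , ≉)) = proj₁ (separate S ≉)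
          𝒜 (inj₂ (_ , _ , ≉)) = swap-amalgam (proj₁ (separate (swap S) ≉))

          𝒟 : Distinct B ⊎ Distinct C → CRL τ ℓ
          𝒟 i = PartialAmalgam.D (𝒜 i)

corollary3p5 : ∀ {ℓ : Level} → ExcludedMiddle (lsuc ℓ) → ZornsLemma (lsuc ℓ) →
    ∀ (τ : Signature) (E : Theory τ ℓ) → Semilinear E →
    AmalgamationProperty (Variety E) ⇔ EssentialAmalgamationProperty (FSI (Variety E))
corollary3p5 em zorn τ E semilinear = mk⇔ (AP⇒EAP zorn E) (EAP⇒AP zorn E semilinear)
  where open Classical em
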